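{- Work in the ring $\mathcal O_{\mathbb{Q}(\sqrt{ -3})}=\mathbb{Z}[\frac{1+\sqrt{ -3}}{2}]$. If $a$ and $b$ are relatively prime positive integers and $3$ divides $a$ in $\mathbb{Z}$, then there is no nonzero $z\in\mathcal O_{\mathbb{Q}(\sqrt{ -3})}$ with $I_2^*(z)=a/b$.
   Context: $\mathcal O_{\mathbb{Q}(\sqrt{ -3})}$ is a unique factorization domain. $|z|=\sqrt{z\bar z}$, $\arg(z)\in[0,2\pi)$. Let $A$ be the set of nonzero $z\in\mathcal O_{\mathbb{Q}(\sqrt{ -3})}$ with $0\le \arg(z)<\pi/3$. Two elements are relatively prime if they have no nonunit common divisor. For nonzero $x,z$, write $x\Diamond z$ iff $x\in A$, $x\mid z$, and $x$ is relatively prime to $z/x$. For $m\in\mathbb{Z}$ define $\delta_m^*(z)=\sum_{x\Diamond z}|x|^m$ and $I_m^*(z)=\delta_m^*(z)/|z|^m$. -}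

module Defs where

open import Algebra.Bundles using (CommutativeRing)
open import Algebra.Structures using (IsCommutativeRing)
open import Data.Integer as ℤ using (ℤ; +_; -[1+_]; 0ℤ; 1ℤ)
import Data.Integer.Properties as ℤ
open import Data.Integer.Tactic.RingSolver using (solve-∀)
open import Data.List using (List; _++_; map; filter; upTo; cartesianProductWith)
open import Data.List.Membership.Propositional using (_∈_; lose; find)
open import Data.List.Membership.Propositional.Properties
  using (∈-map⁺; ∈-map⁻; ∈-++⁺ˡ; ∈-++⁺ʳ; ∈-upTo⁺; ∈-cartesianProductWith⁺; ∈-filter⁺; ∈-filter⁻)
import Data.List.Relation.Unary.All as All
import Data.List.Relation.Unary.Any as Any
open import Data.List.Relation.Unary.Unique.Propositional using (Unique)
import Data.List.Relation.Unary.Unique.Propositional.Properties as Unique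
open import Data.Nat as ℕ using (ℕ; suc; z≤n; s≤s)
open import Data.Nat.ListAction using (sum)
import Data.Nat.Properties as ℕ
open import Data.Product using (Σ-syntax; _×_; _,_; proj₁; proj₂)
open import Data.Rational as ℚ using (ℚ)
open import Function using (_∘_; _⇔_; mk⇔)
open import Level using (0ℓ)
open import Relation.Binary.Definitions using (DecidableEquality)
open import Relation.Binary.PropositionalEquality
open import Relation.Nullary using (¬_; Dec; yes; no)
open import Relation.Nullary.Decidable as Dec using (_×-dec_; _→-dec_)

-- ⟨ a , b ⟩ stands for a + b ω with ω = (1 + √-3) / 2, so that ω² = ω - 1.
record 𝓞 : Set where
  constructor ⟨_,_⟩
  field
    c₁ cω : ℤ

open 𝓞 public

infixl 6 _+_
infixl 7 _*_
infix  8 -_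

0# 1# : 𝓞
0# = ⟨ 0ℤ , 0ℤ ⟩
1# = ⟨ 1ℤ , 0ℤ ⟩

_+_ _*_ : 𝓞 → 𝓞 → 𝓞
⟨ a , b ⟩ + ⟨ c , d ⟩ = ⟨ a ℤ.+ c , b ℤ.+ d ⟩
⟨ a , b ⟩ * ⟨ c , d ⟩ = ⟨ a ℤ.* c ℤ.- b ℤ.* d , a ℤ.* d ℤ.+ b ℤ.* c ℤ.+ b ℤ.* d ⟩

-_ : 𝓞 → 𝓞
- ⟨ a , b ⟩ = ⟨ ℤ.- a , ℤ.- b ⟩

infix 4 _≟_

_≟_ : DecidableEquality 𝓞
⟨ a , b ⟩ ≟ ⟨ c , d ⟩ =
  Dec.map′ (λ (p , q) → cong₂ ⟨_,_⟩ p q) (λ p → cong c₁ p , cong cω p)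
    ((a ℤ.≟ c) ×-dec (b ℤ.≟ d))

*-comm : ∀ x y → x * y ≡ y * x
*-comm ⟨ a , b ⟩ ⟨ c , d ⟩ = cong₂ ⟨_,_⟩ (p a b c d) (q a b c d)
  where
  p : ∀ a b c d → a ℤ.* c ℤ.- b ℤ.* d ≡ c ℤ.* a ℤ.- d ℤ.* b
  p = solve-∀
  q : ∀ a b c d → a ℤ.* d ℤ.+ b ℤ.* c ℤ.+ b ℤ.* d ≡ c ℤ.* b ℤ.+ d ℤ.* a ℤ.+ d ℤ.* b
  q = solve-∀

*-assoc : ∀ x y z → (x * y) * z ≡ x * (y * z)
*-assoc ⟨ a , b ⟩ ⟨ c , d ⟩ ⟨ e , f ⟩ = cong₂ ⟨_,_⟩ (p a b c d e f) (q a b c d e f)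
  where
  p : ∀ a b c d e f →
      (a ℤ.* c ℤ.- b ℤ.* d) ℤ.* e ℤ.- (a ℤ.* d ℤ.+ b ℤ.* c ℤ.+ b ℤ.* d) ℤ.* f ≡
      a ℤ.* (c ℤ.* e ℤ.- d ℤ.* f) ℤ.- b ℤ.* (c ℤ.* f ℤ.+ d ℤ.* e ℤ.+ d ℤ.* f)
  p = solve-∀
  q : ∀ a b c d e f →
      (a ℤ.* c ℤ.- b ℤ.* d) ℤ.* f ℤ.+ (a ℤ.* d ℤ.+ b ℤ.* c ℤ.+ b ℤ.* d) ℤ.* e
        ℤ.+ (a ℤ.* d ℤ.+ b ℤ.* c ℤ.+ b ℤ.* d) ℤ.* f ≡
      a ℤ.* (c ℤ.* f ℤ.+ d ℤ.* e ℤ.+ d ℤ.* f) ℤ.+ b ℤ.* (c ℤ.* e ℤ.- d ℤ.* f)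
        ℤ.+ b ℤ.* (c ℤ.* f ℤ.+ d ℤ.* e ℤ.+ d ℤ.* f)
  q = solve-∀

*-identityˡ : ∀ x → 1# * x ≡ x
*-identityˡ ⟨ a , b ⟩ = cong₂ ⟨_,_⟩ (p a b) (q a b)
  where
  p : ∀ a b → 1ℤ ℤ.* a ℤ.- 0ℤ ℤ.* b ≡ a
  p = solve-∀
  q : ∀ a b → 1ℤ ℤ.* b ℤ.+ 0ℤ ℤ.* a ℤ.+ 0ℤ ℤ.* b ≡ b
  q = solve-∀

*-distribˡ-+ : ∀ x y z → x * (y + z) ≡ x * y + x * z
*-distribˡ-+ ⟨ a , b ⟩ ⟨ c , d ⟩ ⟨ e , f ⟩ = cong₂ ⟨_,_⟩ (p a b c d e f) (q a b c d e f)
  where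
  p : ∀ a b c d e f →
      a ℤ.* (c ℤ.+ e) ℤ.- b ℤ.* (d ℤ.+ f) ≡
      a ℤ.* c ℤ.- b ℤ.* d ℤ.+ (a ℤ.* e ℤ.- b ℤ.* f)
  p = solve-∀
  q : ∀ a b c d e f →
      a ℤ.* (d ℤ.+ f) ℤ.+ b ℤ.* (c ℤ.+ e) ℤ.+ b ℤ.* (d ℤ.+ f) ≡
      a ℤ.* d ℤ.+ b ℤ.* c ℤ.+ b ℤ.* d ℤ.+ (a ℤ.* f ℤ.+ b ℤ.* e ℤ.+ b ℤ.* f)
  q = solve-∀

isCommutativeRing : IsCommutativeRing _≡_ _+_ _*_ -_ 0# 1#
isCommutativeRing = record
  { isRing = record
    { +-isAbelianGroup = record
      { isGroup = record
        { isMonoid = record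
          { isSemigroup = record
            { isMagma = record { isEquivalence = isEquivalence ; ∙-cong = cong₂ _+_ }
            ; assoc = λ (⟨ a , b ⟩) (⟨ c , d ⟩) (⟨ e , f ⟩) →
                cong₂ ⟨_,_⟩ (ℤ.+-assoc a c e) (ℤ.+-assoc b d f)
            }
          ; identity = (λ (⟨ a , b ⟩) → cong₂ ⟨_,_⟩ (ℤ.+-identityˡ a) (ℤ.+-identityˡ b))
                     , (λ (⟨ a , b ⟩) → cong₂ ⟨_,_⟩ (ℤ.+-identityʳ a) (ℤ.+-identityʳ b))
          }
        ; inverse = (λ (⟨ a , b ⟩) → cong₂ ⟨_,_⟩ (ℤ.+-inverseˡ a) (ℤ.+-inverseˡ b))
                  , (λ (⟨ a , b ⟩) → cong₂ ⟨_,_⟩ (ℤ.+-inverseʳ a) (ℤ.+-inverseʳ b))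
        ; ⁻¹-cong = cong -_
        }
      ; comm = λ (⟨ a , b ⟩) (⟨ c , d ⟩) → cong₂ ⟨_,_⟩ (ℤ.+-comm a c) (ℤ.+-comm b d)
      }
    ; *-cong = cong₂ _*_
    ; *-assoc = *-assoc
    ; *-identity = *-identityˡ , λ x → trans (*-comm x 1#) (*-identityˡ x)
    ; distrib = *-distribˡ-+
              , λ x y z → trans (*-comm (y + z) x)
                  (trans (*-distribˡ-+ x y z) (cong₂ _+_ (*-comm x y) (*-comm x z)))
    }
  ; *-comm = *-comm
  }

𝓞-commutativeRing : CommutativeRing 0ℓ 0ℓ
𝓞-commutativeRing = record { isCommutativeRing = isCommutativeRing }

-- Coprime x y unfolds to: every common divisor of x and y divides 1#, i.e. is a unit.
open import Algebra.Properties.Semiring.Divisibility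
  (CommutativeRing.semiring 𝓞-commutativeRing) public
  using (_∣_)
open import Algebra.Properties.Semiring.Primality
  (CommutativeRing.semiring 𝓞-commutativeRing) public
  using (Coprime)
open import Algebra.Definitions.RawMagma using (_,_)

-- Complex conjugation: the conjugate of ω is 1 - ω.
conj : 𝓞 → 𝓞
conj ⟨ a , b ⟩ = ⟨ a ℤ.+ b , ℤ.- b ⟩

-- |z|² = z z̄, which by z*conj-z is the image of a natural number.
∣_∣² : 𝓞 → ℕ
∣ z ∣² = ℤ.∣ c₁ (z * conj z) ∣

-- The nonzero z with 0 ≤ arg z < π/3: since ω = exp (iπ/3), this sector is the
-- cone spanned by 1 and ω, without the ray through ω.
A : 𝓞 → Set
A ⟨ a , b ⟩ = 0ℤ ℤ.< a × 0ℤ ℤ.≤ b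

infix 4 _◇_

-- x ≢ 0# by A⇒≢0, so the witness z/x of x ∣ z is unique.  Only used for z ≢ 0#.
_◇_ : 𝓞 → 𝓞 → Set
x ◇ z = A x × Σ[ (z/x , _) ∈ x ∣ z ] Coprime x z/x

private
  square : ∀ i → i ℤ.* i ≡ + (ℤ.∣ i ∣ ℕ.* ℤ.∣ i ∣)
  square (+ n)    = sym (ℤ.pos-* n n)
  square -[1+ n ] = refl

  4N : ∀ a b → + 4 ℤ.* (a ℤ.* (a ℤ.+ b) ℤ.- b ℤ.* (ℤ.- b)) ≡
               + (ℤ.∣ a ℤ.+ a ℤ.+ b ∣ ℕ.* ℤ.∣ a ℤ.+ a ℤ.+ b ∣ ℕ.+ 3 ℕ.* (ℤ.∣ b ∣ ℕ.* ℤ.∣ b ∣))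
  4N a b = begin
    + 4 ℤ.* (a ℤ.* (a ℤ.+ b) ℤ.- b ℤ.* (ℤ.- b))  ≡⟨ p a b ⟩
    s ℤ.* s ℤ.+ + 3 ℤ.* (b ℤ.* b)                ≡⟨ cong₂ (λ u v → u ℤ.+ + 3 ℤ.* v) (square s) (square b) ⟩
    + (∣s∣ ℕ.* ∣s∣) ℤ.+ + 3 ℤ.* + (∣b∣ ℕ.* ∣b∣)  ≡⟨ cong (λ v → + (∣s∣ ℕ.* ∣s∣) ℤ.+ v) (ℤ.pos-* 3 (∣b∣ ℕ.* ∣b∣)) ⟨
    + (∣s∣ ℕ.* ∣s∣) ℤ.+ + (3 ℕ.* (∣b∣ ℕ.* ∣b∣))  ≡⟨ ℤ.pos-+ (∣s∣ ℕ.* ∣s∣) (3 ℕ.* (∣b∣ ℕ.* ∣b∣)) ⟨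
    + (∣s∣ ℕ.* ∣s∣ ℕ.+ 3 ℕ.* (∣b∣ ℕ.* ∣b∣))      ∎
    where
    open ≡-Reasoning
    s = a ℤ.+ a ℤ.+ b
    ∣s∣ = ℤ.∣ s ∣
    ∣b∣ = ℤ.∣ b ∣
    p : ∀ a b → + 4 ℤ.* (a ℤ.* (a ℤ.+ b) ℤ.- b ℤ.* (ℤ.- b)) ≡
        (a ℤ.+ a ℤ.+ b) ℤ.* (a ℤ.+ a ℤ.+ b) ℤ.+ + 3 ℤ.* (b ℤ.* b)
    p = solve-∀

c₁-z*conj-z : ∀ z → c₁ (z * conj z) ≡ + ∣ z ∣²
c₁-z*conj-z ⟨ a , b ⟩ = sym (ℤ.0≤i⇒+∣i∣≡i
  (ℤ.*-cancelˡ-≤-pos 0ℤ _ (+ 4) (subst (0ℤ ℤ.≤_) (sym (4N a b)) (ℤ.+≤+ z≤n))))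

z*conj-z : ∀ z → z * conj z ≡ ⟨ + ∣ z ∣² , 0ℤ ⟩
z*conj-z z@(⟨ a , b ⟩) = cong₂ ⟨_,_⟩ (c₁-z*conj-z z) (p a b)
  where
  p : ∀ a b → a ℤ.* (ℤ.- b) ℤ.+ b ℤ.* (a ℤ.+ b) ℤ.+ b ℤ.* (ℤ.- b) ≡ 0ℤ
  p = solve-∀

∣∣²-* : ∀ x y → ∣ x * y ∣² ≡ ∣ x ∣² ℕ.* ∣ y ∣²
∣∣²-* x@(⟨ a , b ⟩) y@(⟨ c , d ⟩) =
  trans (cong ℤ.∣_∣ (p a b c d)) (ℤ.abs-* (c₁ (x * conj x)) (c₁ (y * conj y)))
  where
  p : ∀ a b c d →
      (a ℤ.* c ℤ.- b ℤ.* d) ℤ.* ((a ℤ.* c ℤ.- b ℤ.* d) ℤ.+ (a ℤ.* d ℤ.+ b ℤ.* c ℤ.+ b ℤ.* d))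
        ℤ.- (a ℤ.* d ℤ.+ b ℤ.* c ℤ.+ b ℤ.* d) ℤ.* (ℤ.- (a ℤ.* d ℤ.+ b ℤ.* c ℤ.+ b ℤ.* d)) ≡
      (a ℤ.* (a ℤ.+ b) ℤ.- b ℤ.* (ℤ.- b)) ℤ.* (c ℤ.* (c ℤ.+ d) ℤ.- d ℤ.* (ℤ.- d))
  p = solve-∀

private
  3∣cω∣²≤4∣z∣² : ∀ z → 3 ℕ.* (ℤ.∣ cω z ∣ ℕ.* ℤ.∣ cω z ∣) ℕ.≤ 4 ℕ.* ∣ z ∣²
  3∣cω∣²≤4∣z∣² z@(⟨ a , b ⟩) = ℕ.≤-trans (ℕ.m≤n+m _ (ℤ.∣ s ∣ ℕ.* ℤ.∣ s ∣)) (ℕ.≤-reflexive (sym eq))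
    where
    s = a ℤ.+ a ℤ.+ b
    eq : 4 ℕ.* ∣ z ∣² ≡ ℤ.∣ s ∣ ℕ.* ℤ.∣ s ∣ ℕ.+ 3 ℕ.* (ℤ.∣ b ∣ ℕ.* ℤ.∣ b ∣)
    eq = ℤ.+-injective (trans (ℤ.pos-* 4 ∣ z ∣²)
           (trans (cong (λ v → + 4 ℤ.* v) (sym (c₁-z*conj-z z))) (4N a b)))

  swap : 𝓞 → 𝓞
  swap ⟨ a , b ⟩ = ⟨ b , a ⟩

  ∣swap∣² : ∀ z → ∣ swap z ∣² ≡ ∣ z ∣²
  ∣swap∣² ⟨ a , b ⟩ = cong ℤ.∣_∣ (p a b)
    where
    p : ∀ a b → b ℤ.* (b ℤ.+ a) ℤ.- a ℤ.* (ℤ.- a) ≡ a ℤ.* (a ℤ.+ b) ℤ.- b ℤ.* (ℤ.- b)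
    p = solve-∀

  n≤N : ∀ n N → 3 ℕ.* (n ℕ.* n) ℕ.≤ 4 ℕ.* N → n ℕ.≤ N
  n≤N 0 N h = z≤n
  n≤N 1 (suc N) h = s≤s z≤n
  n≤N n@(suc (suc _)) N h = ℕ.*-cancelˡ-≤ 4 (begin
    4 ℕ.* n          ≤⟨ ℕ.*-monoˡ-≤ n (ℕ.m≤m+n 4 2) ⟩
    6 ℕ.* n          ≡⟨ ℕ.*-assoc 3 2 n ⟩
    3 ℕ.* (2 ℕ.* n)  ≤⟨ ℕ.*-monoʳ-≤ 3 (ℕ.*-monoˡ-≤ n {2} {n} (s≤s (s≤s z≤n))) ⟩
    3 ℕ.* (n ℕ.* n)  ≤⟨ h ⟩
    4 ℕ.* N          ∎)
    where open ℕ.≤-Reasoning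

∣cω∣≤∣z∣² : ∀ z → ℤ.∣ cω z ∣ ℕ.≤ ∣ z ∣²
∣cω∣≤∣z∣² z = n≤N _ _ (3∣cω∣²≤4∣z∣² z)

∣c₁∣≤∣z∣² : ∀ z → ℤ.∣ c₁ z ∣ ℕ.≤ ∣ z ∣²
∣c₁∣≤∣z∣² z = subst (ℤ.∣ c₁ z ∣ ℕ.≤_) (∣swap∣² z) (∣cω∣≤∣z∣² (swap z))

∣z∣²≡0⇒z≡0 : ∀ z → ∣ z ∣² ≡ 0 → z ≡ 0#
∣z∣²≡0⇒z≡0 z eq = cong₂ ⟨_,_⟩ (lemma (c₁ z) (∣c₁∣≤∣z∣² z)) (lemma (cω z) (∣cω∣≤∣z∣² z))
  where
  lemma : ∀ i → ℤ.∣ i ∣ ℕ.≤ ∣ z ∣² → i ≡ 0ℤ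
  lemma i le = ℤ.∣i∣≡0⇒i≡0 (ℕ.n≤0⇒n≡0 (subst (ℤ.∣ i ∣ ℕ.≤_) eq le))

∣z∣²-nonZero : ∀ {z} → z ≢ 0# → ℕ.NonZero ∣ z ∣²
∣z∣²-nonZero {z} z≢0 = ℕ.≢-nonZero (z≢0 ∘ ∣z∣²≡0⇒z≡0 z)

A⇒≢0 : ∀ {x} → A x → x ≢ 0#
A⇒≢0 (0<a , _) refl = ℤ.<-irrefl refl 0<a

private
  zeroˡ : ∀ x → 0# * x ≡ 0#
  zeroˡ = CommutativeRing.zeroˡ 𝓞-commutativeRing

∣⇒∣∣²≤ : ∀ {x z} → z ≢ 0# → x ∣ z → ∣ x ∣² ℕ.≤ ∣ z ∣²
∣⇒∣∣²≤ {x} {z} z≢0 (q , qx≡z) =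
  subst (∣ x ∣² ℕ.≤_) (trans (sym (∣∣²-* q x)) (cong ∣_∣² qx≡z))
    (ℕ.m≤n*m ∣ x ∣² ∣ q ∣² {{∣z∣²-nonZero {q} λ { refl → z≢0 (trans (sym qx≡z) (zeroˡ x)) }}})

-- All ⟨ a , b ⟩ with -n ≤ a, b ≤ n.
interval : ℕ → List ℤ
interval n = map (+_) (upTo (suc n)) ++ map -[1+_] (upTo n)

box : ℕ → List 𝓞
box n = cartesianProductWith ⟨_,_⟩ (interval n) (interval n)

∈-interval : ∀ {n} i → ℤ.∣ i ∣ ℕ.≤ n → i ∈ interval n
∈-interval     (+ m)    m≤n = ∈-++⁺ˡ (∈-map⁺ (+_) (∈-upTo⁺ (s≤s m≤n)))
∈-interval {n} -[1+ m ] m<n = ∈-++⁺ʳ (map (+_) (upTo (suc n))) (∈-map⁺ -[1+_] (∈-upTo⁺ m<n))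

interval-unique : ∀ n → Unique (interval n)
interval-unique n = Unique.++⁺
  (Unique.map⁺ ℤ.+-injective (Unique.upTo⁺ (suc n)))
  (Unique.map⁺ ℤ.-[1+-injective (Unique.upTo⁺ n))
  λ (p , q) → disjoint (∈-map⁻ (+_) p) (∈-map⁻ -[1+_] q)
  where
  disjoint : ∀ {i} → Σ[ m ∈ ℕ ] (m ∈ upTo (suc n) × i ≡ + m) →
             ¬ (Σ[ m ∈ ℕ ] (m ∈ upTo n × i ≡ -[1+ m ]))
  disjoint (_ , _ , refl) (_ , _ , ())

box-unique : ∀ n → Unique (box n)
box-unique n = Unique.cartesianProductWith⁺ ⟨_,_⟩ (λ { refl → refl , refl })
  (interval-unique n) (interval-unique n)

∣⇒∈box : ∀ {x z} → z ≢ 0# → x ∣ z → x ∈ box ∣ z ∣²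
∣⇒∈box {x} z≢0 x∣z = ∈-cartesianProductWith⁺ ⟨_,_⟩
  (∈-interval (c₁ x) (ℕ.≤-trans (∣c₁∣≤∣z∣² x) (∣⇒∣∣²≤ z≢0 x∣z)))
  (∈-interval (cω x) (ℕ.≤-trans (∣cω∣≤∣z∣² x) (∣⇒∣∣²≤ z≢0 x∣z)))

infix 4 _∣?_

_∣?_ : ∀ x z → Dec (x ∣ z)
x ∣? z with z ≟ 0#
... | yes refl = yes (0# , zeroˡ x)
... | no z≢0   = Dec.map′
  (λ p → let q , _ , eq = find p in q , eq)
  (λ (q , eq) → lose (∣⇒∈box z≢0 (x , trans (*-comm x q) eq)) eq)
  (Any.any? (λ q → q * x ≟ z) (box ∣ z ∣²))

coprime? : ∀ {x} → x ≢ 0# → ∀ y → Dec (Coprime x y)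
coprime? {x} x≢0 y = Dec.map′
  (λ h d∣x → All.lookup h (∣⇒∈box x≢0 d∣x) d∣x)
  (λ h → All.tabulate λ _ → h)
  (All.all? (λ d → (d ∣? x) →-dec ((d ∣? y) →-dec (d ∣? 1#))) (box ∣ x ∣²))

◇-dec : ∀ {z} → z ≢ 0# → ∀ x → Dec (x ◇ z)
◇-dec {z} z≢0 x@(⟨ a , b ⟩) with (0ℤ ℤ.<? a) ×-dec (0ℤ ℤ.≤? b)
... | no ¬Ax = no (¬Ax ∘ proj₁)
... | yes Ax = Dec.map′ from to (Any.any? (λ q → (q * x ≟ z) ×-dec coprime? (A⇒≢0 Ax) q) (box ∣ z ∣²))
  where
  Cofactor : 𝓞 → Set
  Cofactor q = q * x ≡ z × Coprime x q
  from : Any.Any Cofactor (box ∣ z ∣²) → x ◇ z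
  from p with q , _ , eq , coprime ← find p = Ax , (q , eq) , λ {d} → coprime {d}
  to : x ◇ z → Any.Any Cofactor (box ∣ z ∣²)
  to (_ , (q , eq) , coprime) =
    lose (∣⇒∈box z≢0 (x , trans (*-comm x q) eq)) (eq , λ {d} → coprime {d})

-- The x with x ◇ z, each listed exactly once (∈-unitaryDivisors, unitaryDivisors-unique).
unitaryDivisors : ∀ z → z ≢ 0# → List 𝓞
unitaryDivisors z z≢0 = filter (◇-dec z≢0) (box ∣ z ∣²)

∈-unitaryDivisors : ∀ z (z≢0 : z ≢ 0#) {x} → x ∈ unitaryDivisors z z≢0 ⇔ x ◇ z
∈-unitaryDivisors z z≢0 = mk⇔
  (λ x∈ → proj₂ (∈-filter⁻ (◇-dec z≢0) {xs = box ∣ z ∣²} x∈))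
  (λ x◇z → ∈-filter⁺ (◇-dec z≢0) (∣⇒∈box z≢0 (proj₁ (proj₂ x◇z))) x◇z)

unitaryDivisors-unique : ∀ z (z≢0 : z ≢ 0#) → Unique (unitaryDivisors z z≢0)
unitaryDivisors-unique z z≢0 = Unique.filter⁺ (◇-dec z≢0) (box-unique ∣ z ∣²)

-- δ*ₘ and I*ₘ for m = 2; here all the terms |x|² are natural numbers.
δ*₂ : ∀ z → z ≢ 0# → ℕ
δ*₂ z z≢0 = sum (map ∣_∣² (unitaryDivisors z z≢0))

I*₂ : ∀ z → z ≢ 0# → ℚ
I*₂ z z≢0 = ℚ._/_ (+ δ*₂ z z≢0) ∣ z ∣² {{∣z∣²-nonZero z≢0}}

module Submission where

-- The sum δ*₂ is multiplicative: if x and y are coprime, (d , e) ↦ d e is, up to associates,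
-- a bijection from pairs of unitary divisors of x and of y to the unitary divisors of x y.
-- If z has no unitary divisors besides 1 and z, then δ*₂ z is 1 or 1 + |z|², and
-- |z|² = a² + ab + b² ≡ (a - b)² (mod 3), so that 3 ∤ δ*₂ z; by induction on |z|² this holds
-- for all z.  Hence 3 cannot divide the numerator of δ*₂ z / |z|² in lowest terms.

open import Defs
open import Algebra.Bundles using (CommutativeRing)
open import Algebra.Definitions.RawMagma using (_,_)
open import Data.Integer as ℤ using (ℤ; +_; -[1+_]; 0ℤ; 1ℤ; -1ℤ; _/ℕ_; _%ℕ_; +≤+; +<+)
open import Data.Integer.DivMod using (n%ℕd<d; a≡a%ℕn+[a/ℕn]*n)
import Data.Integer.Divisibility.Signed as ℤ∣
import Data.Integer.Properties as ℤ
import Data.Integer.Tactic.RingSolver as ℤSolver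
open import Data.List using (List; []; _∷_; _++_; map; cartesianProduct)
open import Data.List.Membership.Propositional using (_∈_; find)
open import Data.List.Membership.Propositional.Properties
  using (∈-map⁺; ∈-map⁻; ∈-cartesianProduct⁺; ∈-cartesianProduct⁻)
open import Data.List.Membership.Propositional.Properties.WithK using (unique∧set⇒bag)
open import Data.List.Properties using (map-++; map-∘; map-cong)
open import Data.List.Relation.Binary.BagAndSetEquality using (∼bag⇒↭)
open import Data.List.Relation.Binary.Permutation.Propositional using (_↭_)
import Data.List.Relation.Binary.Permutation.Propositional.Properties as ↭
open import Data.List.Relation.Unary.All as All using (All; []; _∷_)
import Data.List.Relation.Unary.All.Properties as All
open import Data.List.Relation.Unary.AllPairs using ([]; _∷_)
open import Data.List.Relation.Unary.Any as Any using (here; there)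
open import Data.List.Relation.Unary.Unique.Propositional using (Unique)
import Data.List.Relation.Unary.Unique.Propositional.Properties as Unique
open import Data.Nat as ℕ using (ℕ; NonZero; suc; z≤n; s≤s)
open import Data.Nat.Coprimality renaming (Coprime to Coprimeℕ) using ()
open import Data.Nat.Divisibility renaming (_∣_ to _∣ℕ_; _∣?_ to _∣ℕ?_) using (∣m⇒∣m*n)
open import Data.Nat.Induction using (Acc; acc; <-wellFounded)
open import Data.Nat.ListAction using (sum)
open import Data.Nat.ListAction.Properties using (sum-++; sum-↭)
open import Data.Nat.Primality using (Prime; prime?; euclidsLemma)
import Data.Nat.Properties as ℕ
import Data.Nat.Tactic.RingSolver as ℕSolver
open import Data.Product using (Σ-syntax; ∃₂; _×_; _,_; proj₁; proj₂)
open import Data.Rational using (_/_)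
open import Data.Rational.Properties using (normalize-injective-≃)
open import Data.Sum using (_⊎_; inj₁; inj₂; [_,_]′)
open import Function using (_∘_; _$_; _⇔_; mk⇔; Equivalence)
open import Level using (0ℓ)
open import Relation.Binary.PropositionalEquality
open import Relation.Nullary using (¬_; yes; no; contradiction)
open import Relation.Nullary.Decidable using (_×-dec_; ¬?; dec⇒maybe; from-yes; from-no; recompute)
open import Tactic.RingSolver using (solve-∀)
open import Tactic.RingSolver.Core.AlmostCommutativeRing using (AlmostCommutativeRing; fromCommutativeRing)

private module 𝓞R = CommutativeRing 𝓞-commutativeRing

open import Algebra.Properties.CommutativeSemigroup.Divisibility 𝓞R.*-commutativeSemigroup
  using (∣-trans; ∙-cong-∣)
open import Algebra.Properties.Group 𝓞R.+-group using (x∙y⁻¹≈ε⇒x≈y)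
open import Algebra.Properties.Monoid.Divisibility 𝓞R.*-monoid using (∣ʳ-refl; ε∣ʳ_)
open import Algebra.Properties.Semiring.Divisibility 𝓞R.semiring using (x∣y∧y≉0⇒x≉0)
open import Algebra.Properties.Semiring.Primality 𝓞R.semiring using (Coprime-sym)

-- Absence of zero divisors and cancellation.

𝓞-ring : AlmostCommutativeRing 0ℓ 0ℓ
𝓞-ring = fromCommutativeRing 𝓞-commutativeRing λ x → dec⇒maybe (0# ≟ x)

-- The norm is multiplicative and vanishes only at `0#`, so the absence of zero divisors carries
-- over from the natural numbers.
x*y≡0⇒y≡0 : ∀ {x y} → x ≢ 0# → x * y ≡ 0# → y ≡ 0#
x*y≡0⇒y≡0 {x} {y} x≢0 xy≡0
  with ℕ.m*n≡0⇒m≡0∨n≡0 ∣ x ∣² (trans (sym (∣∣²-* x y)) (cong ∣_∣² xy≡0))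
... | inj₁ ∣x∣²≡0 = contradiction (∣z∣²≡0⇒z≡0 x ∣x∣²≡0) x≢0
... | inj₂ ∣y∣²≡0 = ∣z∣²≡0⇒z≡0 y ∣y∣²≡0

*-≢0 : ∀ {x y} → x ≢ 0# → y ≢ 0# → x * y ≢ 0#
*-≢0 x≢0 y≢0 = y≢0 ∘ x*y≡0⇒y≡0 x≢0

*-cancelˡ : ∀ {x y z} → x ≢ 0# → x * y ≡ x * z → y ≡ z
*-cancelˡ {x} {y} {z} x≢0 xy≡xz = x∙y⁻¹≈ε⇒x≈y y z $ x*y≡0⇒y≡0 x≢0 $ begin
  x * (y + - z)      ≡⟨ distrib x y z ⟩
  x * y + - (x * z)  ≡⟨ cong (λ t → t + - (x * z)) xy≡xz ⟩
  x * z + - (x * z)  ≡⟨ 𝓞R.-‿inverseʳ (x * z) ⟩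
  0#                 ∎
  where
  open ≡-Reasoning
  distrib : ∀ x y z → x * (y + - z) ≡ x * y + - (x * z)
  distrib = solve-∀ 𝓞-ring

-- Euclidean division and greatest common divisors

-- Rounding to a nearest integer: when the ordinary remainder exceeds n/2, the quotient goes up by
-- one and the remainder becomes r - n. A remainder merely below n would be too large for the norm
-- estimate behind Euclidean division.
roundedDivMod : ∀ i n .{{_ : NonZero n}} →
  ∃₂ λ q r → i ≡ r ℤ.+ q ℤ.* + n × 2 ℕ.* ℤ.∣ r ∣ ℕ.≤ n
roundedDivMod i n with 2 ℕ.* (i %ℕ n) ℕ.≤? n
... | yes 2r≤n = i /ℕ n , + (i %ℕ n) , a≡a%ℕn+[a/ℕn]*n i n , 2r≤n
... | no 2r≰n = 1ℤ ℤ.+ i /ℕ n , ℤ.- + (n ℕ.∸ r) , eq , bound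
  where
  r = i %ℕ n
  rearrange : ∀ r q n → r ℤ.+ q ℤ.* n ≡ ℤ.- (n ℤ.- r) ℤ.+ (1ℤ ℤ.+ q) ℤ.* n
  rearrange = ℤSolver.solve-∀
  eq : i ≡ ℤ.- + (n ℕ.∸ r) ℤ.+ (1ℤ ℤ.+ i /ℕ n) ℤ.* + n
  eq = begin
    i  ≡⟨ a≡a%ℕn+[a/ℕn]*n i n ⟩
    + r ℤ.+ i /ℕ n ℤ.* + n  ≡⟨ rearrange (+ r) (i /ℕ n) (+ n) ⟩
    ℤ.- (+ n ℤ.- + r) ℤ.+ (1ℤ ℤ.+ i /ℕ n) ℤ.* + n
      ≡⟨ cong (λ t → ℤ.- t ℤ.+ (1ℤ ℤ.+ i /ℕ n) ℤ.* + n) (trans (ℤ.m-n≡m⊖n n r) (ℤ.⊖-≥ (ℕ.<⇒≤ (n%ℕd<d i n)))) ⟩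
    ℤ.- + (n ℕ.∸ r) ℤ.+ (1ℤ ℤ.+ i /ℕ n) ℤ.* + n  ∎
    where open ≡-Reasoning
  bound : 2 ℕ.* ℤ.∣ ℤ.- + (n ℕ.∸ r) ∣ ℕ.≤ n
  bound = begin
    2 ℕ.* ℤ.∣ ℤ.- + (n ℕ.∸ r) ∣  ≡⟨ cong (2 ℕ.*_) (ℤ.∣-i∣≡∣i∣ (+ (n ℕ.∸ r))) ⟩
    2 ℕ.* (n ℕ.∸ r)              ≡⟨ ℕ.*-distribˡ-∸ 2 n r ⟩
    2 ℕ.* n ℕ.∸ 2 ℕ.* r          ≤⟨ ℕ.m≤n+o⇒m∸n≤o (2 ℕ.* n) (2 ℕ.* r) (begin
      2 ℕ.* n                      ≡⟨ cong (n ℕ.+_) (ℕ.+-identityʳ n) ⟩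
      n ℕ.+ n                      ≤⟨ ℕ.+-monoˡ-≤ n (ℕ.<⇒≤ (ℕ.≰⇒> 2r≰n)) ⟩
      2 ℕ.* r ℕ.+ n                ∎) ⟩
    n                            ∎
    where open ℕ.≤-Reasoning

∣∣²≤ : ∀ z → ∣ z ∣² ℕ.≤ ℤ.∣ c₁ z ∣ ℕ.* ℤ.∣ c₁ z ∣ ℕ.+ ℤ.∣ c₁ z ∣ ℕ.* ℤ.∣ cω z ∣ ℕ.+ ℤ.∣ cω z ∣ ℕ.* ℤ.∣ cω z ∣
∣∣²≤ ⟨ a , b ⟩ = begin
  ℤ.∣ a ℤ.* (a ℤ.+ b) ℤ.- b ℤ.* (ℤ.- b) ∣              ≡⟨ cong ℤ.∣_∣ (expand a b) ⟩
  ℤ.∣ a ℤ.* a ℤ.+ a ℤ.* b ℤ.+ b ℤ.* b ∣                ≤⟨ ℤ.∣i+j∣≤∣i∣+∣j∣ (a ℤ.* a ℤ.+ a ℤ.* b) (b ℤ.* b) ⟩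
  ℤ.∣ a ℤ.* a ℤ.+ a ℤ.* b ∣ ℕ.+ ℤ.∣ b ℤ.* b ∣          ≤⟨ ℕ.+-monoˡ-≤ _ (ℤ.∣i+j∣≤∣i∣+∣j∣ (a ℤ.* a) (a ℤ.* b)) ⟩
  ℤ.∣ a ℤ.* a ∣ ℕ.+ ℤ.∣ a ℤ.* b ∣ ℕ.+ ℤ.∣ b ℤ.* b ∣
    ≡⟨ cong₂ ℕ._+_ (cong₂ ℕ._+_ (ℤ.abs-* a a) (ℤ.abs-* a b)) (ℤ.abs-* b b) ⟩
  ℤ.∣ a ∣ ℕ.* ℤ.∣ a ∣ ℕ.+ ℤ.∣ a ∣ ℕ.* ℤ.∣ b ∣ ℕ.+ ℤ.∣ b ∣ ℕ.* ℤ.∣ b ∣   ∎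
  where
  open ℕ.≤-Reasoning
  expand : ∀ a b → a ℤ.* (a ℤ.+ b) ℤ.- b ℤ.* (ℤ.- b) ≡ a ℤ.* a ℤ.+ a ℤ.* b ℤ.+ b ℤ.* b
  expand = ℤSolver.solve-∀

-- Each of the three terms of |a|² + |a||b| + |b|² is at most n²/4. The resulting ratio 3/4 is below
-- 1, which is what makes the norm Euclidean.
∣∣²-small : ∀ z n → 2 ℕ.* ℤ.∣ c₁ z ∣ ℕ.≤ n → 2 ℕ.* ℤ.∣ cω z ∣ ℕ.≤ n →
  4 ℕ.* ∣ z ∣² ℕ.≤ 3 ℕ.* (n ℕ.* n)
∣∣²-small z n 2k≤n 2l≤n = begin
  4 ℕ.* ∣ z ∣²                                        ≤⟨ ℕ.*-monoʳ-≤ 4 (∣∣²≤ z) ⟩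
  4 ℕ.* (k ℕ.* k ℕ.+ k ℕ.* l ℕ.+ l ℕ.* l)             ≡⟨ double k l ⟩
  2 ℕ.* k ℕ.* (2 ℕ.* k) ℕ.+ 2 ℕ.* k ℕ.* (2 ℕ.* l) ℕ.+ 2 ℕ.* l ℕ.* (2 ℕ.* l)
    ≤⟨ ℕ.+-mono-≤ (ℕ.+-mono-≤ (ℕ.*-mono-≤ 2k≤n 2k≤n) (ℕ.*-mono-≤ 2k≤n 2l≤n)) (ℕ.*-mono-≤ 2l≤n 2l≤n) ⟩
  n ℕ.* n ℕ.+ n ℕ.* n ℕ.+ n ℕ.* n                     ≡⟨ triple (n ℕ.* n) ⟩
  3 ℕ.* (n ℕ.* n)                                     ∎
  where
  open ℕ.≤-Reasoning
  k = ℤ.∣ c₁ z ∣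
  l = ℤ.∣ cω z ∣
  double : ∀ k l → 4 ℕ.* (k ℕ.* k ℕ.+ k ℕ.* l ℕ.+ l ℕ.* l) ≡
           2 ℕ.* k ℕ.* (2 ℕ.* k) ℕ.+ 2 ℕ.* k ℕ.* (2 ℕ.* l) ℕ.+ 2 ℕ.* l ℕ.* (2 ℕ.* l)
  double = ℕSolver.solve-∀
  triple : ∀ m → m ℕ.+ m ℕ.+ m ≡ 3 ℕ.* m
  triple = ℕSolver.solve-∀

∣conj∣² : ∀ z → ∣ conj z ∣² ≡ ∣ z ∣²
∣conj∣² ⟨ a , b ⟩ = cong ℤ.∣_∣ (eq a b)
  where
  eq : ∀ a b → (a ℤ.+ b) ℤ.* (a ℤ.+ b ℤ.+ ℤ.- b) ℤ.- (ℤ.- b) ℤ.* (ℤ.- (ℤ.- b)) ≡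
       a ℤ.* (a ℤ.+ b) ℤ.- b ℤ.* (ℤ.- b)
  eq = ℤSolver.solve-∀

approximate : ∀ z n .{{_ : NonZero n}} →
  ∃₂ λ q ρ → z ≡ ρ + q * ⟨ + n , 0ℤ ⟩ × 4 ℕ.* ∣ ρ ∣² ℕ.≤ 3 ℕ.* (n ℕ.* n)
approximate ⟨ a , b ⟩ n
  with q₁ , r₁ , a≡ , 2r₁≤n ← roundedDivMod a n
  with q₂ , r₂ , b≡ , 2r₂≤n ← roundedDivMod b n =
  ⟨ q₁ , q₂ ⟩ , ⟨ r₁ , r₂ ⟩ ,
  cong₂ ⟨_,_⟩ (trans a≡ (cong (λ i → r₁ ℤ.+ i) (first q₁ q₂ (+ n))))
              (trans b≡ (cong (λ i → r₂ ℤ.+ i) (second q₁ q₂ (+ n)))) ,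
  ∣∣²-small ⟨ r₁ , r₂ ⟩ n 2r₁≤n 2r₂≤n
  where
  first : ∀ i j n → i ℤ.* n ≡ i ℤ.* n ℤ.- j ℤ.* 0ℤ
  first = ℤSolver.solve-∀
  second : ∀ i j n → j ℤ.* n ≡ i ℤ.* 0ℤ ℤ.+ j ℤ.* n ℤ.+ j ℤ.* 0ℤ
  second = ℤSolver.solve-∀

-- x ȳ / |y|² is rounded to q; the remainder r then satisfies r ȳ = ρ, where ρ is small.
divMod : ∀ x {y} → y ≢ 0# → ∃₂ λ q r → x ≡ q * y + r × ∣ r ∣² ℕ.< ∣ y ∣²
divMod x {y} y≢0 = fromApproximation (approximate (x * conj y) ∣ y ∣²)
  where
  instance
    ∣y∣²≢0 : NonZero ∣ y ∣²
    ∣y∣²≢0 = ∣z∣²-nonZero y≢0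
  rearrange : ∀ x p → x ≡ p + (x + - p)
  rearrange = solve-∀ 𝓞-ring
  expand : ∀ x q y ȳ → (x + - (q * y)) * ȳ ≡ x * ȳ + - (q * (y * ȳ))
  expand = solve-∀ 𝓞-ring
  cancel : ∀ ρ t → ρ + t + - t ≡ ρ
  cancel = solve-∀ 𝓞-ring
  fromApproximation :
    (∃₂ λ q ρ → x * conj y ≡ ρ + q * ⟨ + ∣ y ∣² , 0ℤ ⟩ × 4 ℕ.* ∣ ρ ∣² ℕ.≤ 3 ℕ.* (∣ y ∣² ℕ.* ∣ y ∣²)) →
    ∃₂ λ q r → x ≡ q * y + r × ∣ r ∣² ℕ.< ∣ y ∣²
  fromApproximation (q , ρ , xȳ≡ρ+q∣y∣² , 4∣ρ∣²≤) =
    q , r , rearrange x (q * y) ,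
    ℕ.*-cancelˡ-< 4 _ _ (ℕ.≤-<-trans (ℕ.*-cancelʳ-≤ _ _ ∣ y ∣² 4∣r∣²∣y∣²≤) (ℕ.*-monoˡ-< ∣ y ∣² (ℕ.n<1+n 3)))
    where
    r = x + - (q * y)
    rȳ≡ρ : r * conj y ≡ ρ
    rȳ≡ρ = begin
      r * conj y                                            ≡⟨ expand x q y (conj y) ⟩
      x * conj y + - (q * (y * conj y))                     ≡⟨ cong₂ (λ u v → u + - (q * v)) xȳ≡ρ+q∣y∣² (z*conj-z y) ⟩
      ρ + q * ⟨ + ∣ y ∣² , 0ℤ ⟩ + - (q * ⟨ + ∣ y ∣² , 0ℤ ⟩)  ≡⟨ cancel ρ (q * ⟨ + ∣ y ∣² , 0ℤ ⟩) ⟩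
      ρ                                                     ∎
      where open ≡-Reasoning
    4∣r∣²∣y∣²≤ : 4 ℕ.* ∣ r ∣² ℕ.* ∣ y ∣² ℕ.≤ 3 ℕ.* ∣ y ∣² ℕ.* ∣ y ∣²
    4∣r∣²∣y∣²≤ = begin
      4 ℕ.* ∣ r ∣² ℕ.* ∣ y ∣²         ≡⟨ ℕ.*-assoc 4 ∣ r ∣² ∣ y ∣² ⟩
      4 ℕ.* (∣ r ∣² ℕ.* ∣ y ∣²)       ≡⟨ cong (λ m → 4 ℕ.* (∣ r ∣² ℕ.* m)) (∣conj∣² y) ⟨
      4 ℕ.* (∣ r ∣² ℕ.* ∣ conj y ∣²)  ≡⟨ cong (4 ℕ.*_) (∣∣²-* r (conj y)) ⟨
      4 ℕ.* ∣ r * conj y ∣²           ≡⟨ cong (λ w → 4 ℕ.* ∣ w ∣²) rȳ≡ρ ⟩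
      4 ℕ.* ∣ ρ ∣²                    ≤⟨ 4∣ρ∣²≤ ⟩
      3 ℕ.* (∣ y ∣² ℕ.* ∣ y ∣²)       ≡⟨ ℕ.*-assoc 3 ∣ y ∣² ∣ y ∣² ⟨
      3 ℕ.* ∣ y ∣² ℕ.* ∣ y ∣²         ∎
      where open ℕ.≤-Reasoning

-- The extended Euclidean algorithm; it terminates because the norm of the second argument drops at
-- each division.
bézout : ∀ x y → Σ[ d ∈ 𝓞 ] (d ∣ x × d ∣ y × ∃₂ λ u v → u * x + v * y ≡ d)
bézout x y = go x y (<-wellFounded ∣ y ∣²)
  where
  identity : ∀ x → 1# * x + 0# * 0# ≡ x
  identity = solve-∀ 𝓞-ring
  distrib : ∀ q e f d → (q * e + f) * d ≡ q * (e * d) + f * d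
  distrib = solve-∀ 𝓞-ring
  rearrange : ∀ u v q y r → v * (q * y + r) + (u + - (v * q)) * y ≡ u * y + v * r
  rearrange = solve-∀ 𝓞-ring
  go : ∀ x y → Acc ℕ._<_ ∣ y ∣² → Σ[ d ∈ 𝓞 ] (d ∣ x × d ∣ y × ∃₂ λ u v → u * x + v * y ≡ d)
  go x y (acc rec) with y ≟ 0#
  ... | yes y≡0 = x , ∣ʳ-refl , (0# , trans (𝓞R.zeroˡ x) (sym y≡0)) , 1# , 0# ,
                  trans (cong (λ t → 1# * x + 0# * t) y≡0) (identity x)
  ... | no y≢0 =
    let q , r , x≡qy+r , r<y = divMod x y≢0
        d , d∣y@(e , ed≡y) , (f , fd≡r) , u , v , uy+vr≡d = go y r (rec r<y)
    in d ,
       (q * e + f , trans (distrib q e f d) (trans (cong₂ (λ y r → q * y + r) ed≡y fd≡r) (sym x≡qy+r))) ,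
       -- Substituting r = x - q y into d = u y + v r gives d = v x + (u - v q) y.
       d∣y , v , u + - (v * q) ,
       trans (cong (λ t → v * t + (u + - (v * q)) * y) x≡qy+r) (trans (rearrange u v q y r) uy+vr≡d)

coprime-∣ : ∀ {x y x′ y′} → x′ ∣ x → y′ ∣ y → Coprime x y → Coprime x′ y′
coprime-∣ x′∣x y′∣y coprime d∣x′ d∣y′ = coprime (∣-trans d∣x′ x′∣x) (∣-trans d∣y′ y′∣y)

-- The Bézout combination d = u x + v y is only known to be a unit, so it is scaled by its inverse
-- w: then z = w (u x z + v y z), and x divides both terms.
coprime-divisor : ∀ {x y z} → Coprime x y → x ∣ y * z → x ∣ z
coprime-divisor {x} {y} {z} coprime (q , qx≡yz)
  with d , d∣x , d∣y , u , v , ux+vy≡d ← bézout x y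
  with w , wd≡1 ← coprime d∣x d∣y =
  w * (u * z + v * q) , (begin
    w * (u * z + v * q) * x             ≡⟨ rearrange w u v q x z ⟩
    w * (u * x * z + v * (q * x))       ≡⟨ cong (λ t → w * (u * x * z + v * t)) qx≡yz ⟩
    w * (u * x * z + v * (y * z))       ≡⟨ factor w u v x y z ⟩
    w * (u * x + v * y) * z             ≡⟨ cong (λ t → w * t * z) ux+vy≡d ⟩
    w * d * z                           ≡⟨ cong (_* z) wd≡1 ⟩
    1# * z                              ≡⟨ *-identityˡ z ⟩
    z                                   ∎)
  where
  open ≡-Reasoning
  rearrange : ∀ w u v q x z → w * (u * z + v * q) * x ≡ w * (u * x * z + v * (q * x))
  rearrange = solve-∀ 𝓞-ring
  factor : ∀ w u v x y z → w * (u * x * z + v * (y * z)) ≡ w * (u * x + v * y) * z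
  factor = solve-∀ 𝓞-ring

-- A common divisor of x y and z is coprime to x, because it divides z; hence it divides y.
coprime-* : ∀ {x y z} → Coprime x z → Coprime y z → Coprime (x * y) z
coprime-* x⊥z y⊥z d∣xy d∣z =
  y⊥z (coprime-divisor (coprime-∣ d∣z ∣ʳ-refl (Coprime-sym x⊥z)) d∣xy) d∣z

-- Dividing the Bézout identity by d gives u x′ + v y′ = 1, so every common divisor of x′ and y′
-- divides 1. Cancelling d is possible because it divides the nonzero y.
gcd-factor : ∀ x {y} → y ≢ 0# →
  Σ[ d ∈ 𝓞 ] ∃₂ λ x′ y′ → d * x′ ≡ x × d * y′ ≡ y × Coprime x′ y′
gcd-factor x {y} y≢0
  with d , (x′ , x′d≡x) , d∣y@(y′ , y′d≡y) , u , v , ux+vy≡d ← bézout x y =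
  d , x′ , y′ , trans (*-comm d x′) x′d≡x , trans (*-comm d y′) y′d≡y ,
  λ (f , fe≡x′) (g , ge≡y′) → u * f + v * g , *-cancelˡ (x∣y∧y≉0⇒x≉0 d∣y y≢0) (begin
    d * ((u * f + v * g) * _)                  ≡⟨ rearrange d u f v g _ ⟩
    u * (f * _ * d) + v * (g * _ * d)          ≡⟨ cong₂ (λ s t → u * (s * d) + v * (t * d)) fe≡x′ ge≡y′ ⟩
    u * (x′ * d) + v * (y′ * d)                ≡⟨ cong₂ (λ s t → u * s + v * t) x′d≡x y′d≡y ⟩
    u * x + v * y                              ≡⟨ ux+vy≡d ⟩
    d                                          ≡⟨ 𝓞R.*-identityʳ d ⟨
    d * 1#                                     ∎)
  where
  open ≡-Reasoning
  rearrange : ∀ d u f v g e → d * ((u * f + v * g) * e) ≡ u * (f * e * d) + v * (g * e * d)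
  rearrange = solve-∀ 𝓞-ring

-- Units and the sector A

-- The conjugate serves as the inverse.
∣x∣²≡1⇒x∣1 : ∀ {x} → ∣ x ∣² ≡ 1 → x ∣ 1#
∣x∣²≡1⇒x∣1 {x} ∣x∣²≡1 = conj x ,
  trans (*-comm (conj x) x) (trans (z*conj-z x) (cong (λ n → ⟨ + n , 0ℤ ⟩) ∣x∣²≡1))

x∣1⇒∣x∣²≡1 : ∀ {x} → x ∣ 1# → ∣ x ∣² ≡ 1
x∣1⇒∣x∣²≡1 {x} (q , qx≡1) = ℕ.m*n≡1⇒n≡1 ∣ q ∣² ∣ x ∣² (trans (sym (∣∣²-* q x)) (cong ∣_∣² qx≡1))

-- Together with `1#` these are the six units, the rotations by multiples of π/3; here ω³ = -1 and
-- ω⁻² = ω⁴ = -ω.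
ω ω² ω³ ω⁻¹ ω⁻² : 𝓞
ω   = ⟨ 0ℤ , 1ℤ ⟩
ω²  = ⟨ -1ℤ , 1ℤ ⟩
ω³  = ⟨ -1ℤ , 0ℤ ⟩
ω⁻¹ = ⟨ 1ℤ , -1ℤ ⟩
ω⁻² = ⟨ 0ℤ , -1ℤ ⟩

ω*-formula : ∀ a b → ω * ⟨ a , b ⟩ ≡ ⟨ ℤ.- b , a ℤ.+ b ⟩
ω*-formula a b = cong₂ ⟨_,_⟩ (p a b) (q a b)
  where
  p : ∀ a b → 0ℤ ℤ.* a ℤ.- 1ℤ ℤ.* b ≡ ℤ.- b
  p = ℤSolver.solve-∀
  q : ∀ a b → 0ℤ ℤ.* b ℤ.+ 1ℤ ℤ.* a ℤ.+ 1ℤ ℤ.* b ≡ a ℤ.+ b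
  q = ℤSolver.solve-∀

ω²*-formula : ∀ a b → ω² * ⟨ a , b ⟩ ≡ ⟨ ℤ.- (a ℤ.+ b) , a ⟩
ω²*-formula a b = cong₂ ⟨_,_⟩ (p a b) (q a b)
  where
  p : ∀ a b → -1ℤ ℤ.* a ℤ.- 1ℤ ℤ.* b ≡ ℤ.- (a ℤ.+ b)
  p = ℤSolver.solve-∀
  q : ∀ a b → -1ℤ ℤ.* b ℤ.+ 1ℤ ℤ.* a ℤ.+ 1ℤ ℤ.* b ≡ a
  q = ℤSolver.solve-∀

ω³*-formula : ∀ a b → ω³ * ⟨ a , b ⟩ ≡ ⟨ ℤ.- a , ℤ.- b ⟩
ω³*-formula a b = cong₂ ⟨_,_⟩ (p a b) (q a b)
  where
  p : ∀ a b → -1ℤ ℤ.* a ℤ.- 0ℤ ℤ.* b ≡ ℤ.- a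
  p = ℤSolver.solve-∀
  q : ∀ a b → -1ℤ ℤ.* b ℤ.+ 0ℤ ℤ.* a ℤ.+ 0ℤ ℤ.* b ≡ ℤ.- b
  q = ℤSolver.solve-∀

ω⁻¹*-formula : ∀ a b → ω⁻¹ * ⟨ a , b ⟩ ≡ ⟨ a ℤ.+ b , ℤ.- a ⟩
ω⁻¹*-formula a b = cong₂ ⟨_,_⟩ (p a b) (q a b)
  where
  p : ∀ a b → 1ℤ ℤ.* a ℤ.- -1ℤ ℤ.* b ≡ a ℤ.+ b
  p = ℤSolver.solve-∀
  q : ∀ a b → 1ℤ ℤ.* b ℤ.+ -1ℤ ℤ.* a ℤ.+ -1ℤ ℤ.* b ≡ ℤ.- a
  q = ℤSolver.solve-∀

ω⁻²*-formula : ∀ a b → ω⁻² * ⟨ a , b ⟩ ≡ ⟨ b , ℤ.- (a ℤ.+ b) ⟩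
ω⁻²*-formula a b = cong₂ ⟨_,_⟩ (p a b) (q a b)
  where
  p : ∀ a b → 0ℤ ℤ.* a ℤ.- -1ℤ ℤ.* b ≡ b
  p = ℤSolver.solve-∀
  q : ∀ a b → 0ℤ ℤ.* b ℤ.+ -1ℤ ℤ.* a ℤ.+ -1ℤ ℤ.* b ≡ ℤ.- (a ℤ.+ b)
  q = ℤSolver.solve-∀

-- The plane without the origin is the union of six rotated copies of the sector, and the signs of
-- a, b and a + b tell which copy contains x. The inverse v of the rotation u is kept as evidence
-- that u is a unit.
rotation : ∀ x → x ≢ 0# → ∃₂ λ u v → v * u ≡ 1# × A (u * x)
rotation x@(⟨ a , b ⟩) x≢0 with 0ℤ ℤ.<? a
... | yes 0<a with 0ℤ ℤ.≤? b | 0ℤ ℤ.≤? a ℤ.+ b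
...   | yes 0≤b | _         = 1# , 1# , refl , subst A (sym (*-identityˡ x)) (0<a , 0≤b)
...   | no 0≰b  | yes 0≤a+b = ω , ω⁻¹ , refl ,
  subst A (sym (ω*-formula a b)) (ℤ.neg-mono-< (ℤ.≰⇒> 0≰b) , 0≤a+b)
...   | no 0≰b  | no 0≰a+b  = ω² , ω⁻² , refl ,
  subst A (sym (ω²*-formula a b)) (ℤ.neg-mono-< (ℤ.≰⇒> 0≰a+b) , ℤ.<⇒≤ 0<a)
rotation x@(⟨ a , b ⟩) x≢0 | no 0≮a with 0ℤ ℤ.<? b | 0ℤ ℤ.<? a ℤ.+ b
...   | yes 0<b | yes 0<a+b = ω⁻¹ , ω , refl ,
  subst A (sym (ω⁻¹*-formula a b)) (0<a+b , ℤ.neg-mono-≤ (ℤ.≮⇒≥ 0≮a))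
...   | yes 0<b | no 0≮a+b  = ω⁻² , ω² , refl ,
  subst A (sym (ω⁻²*-formula a b)) (0<b , ℤ.neg-mono-≤ (ℤ.≮⇒≥ 0≮a+b))
...   | no 0≮b  | _ with a ℤ.≟ 0ℤ
...     | no a≢0 = ω³ , ω³ , refl ,
  subst A (sym (ω³*-formula a b)) (ℤ.neg-mono-< (ℤ.≤∧≢⇒< (ℤ.≮⇒≥ 0≮a) a≢0) , ℤ.neg-mono-≤ (ℤ.≮⇒≥ 0≮b))
-- Here x is a negative multiple of ω, with argument 4π/3; rotation by 2π/3 puts it on the positive
-- real axis, the closed edge of the sector.
...     | yes refl = ω² , ω⁻² , refl ,
  subst A (sym (ω²*-formula a b))
    ( ℤ.neg-mono-< (subst (ℤ._< 0ℤ) (sym (ℤ.+-identityˡ b)) (ℤ.≤∧≢⇒< (ℤ.≮⇒≥ 0≮b) (λ { refl → x≢0 refl })))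
    , ℤ.≤-refl )

private
  <∧≤⇒sum≢0 : ∀ {i j} → 0ℤ ℤ.< i → 0ℤ ℤ.≤ j → i ℤ.+ j ≢ 0ℤ
  <∧≤⇒sum≢0 0<i 0≤j i+j≡0 = ℤ.<-irrefl (sym i+j≡0) (ℤ.+-mono-<-≤ 0<i 0≤j)

-- Norm 1 confines both coordinates of u to -1, 0, 1. Of the nine candidates three have the wrong
-- norm, and each unit other than 1 makes some number positive whose negative is nonnegative, or the
-- reverse.
A-fixes-unit : ∀ u x → ∣ u ∣² ≡ 1 → A x → A (u * x) → u ≡ 1#
A-fixes-unit u x ∣u∣²≡1 Ax Aux =
  go u x ∣u∣²≡1 (subst (ℤ.∣ c₁ u ∣ ℕ.≤_) ∣u∣²≡1 (∣c₁∣≤∣z∣² u))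
    (subst (ℤ.∣ cω u ∣ ℕ.≤_) ∣u∣²≡1 (∣cω∣≤∣z∣² u)) Ax Aux
  where
  go : ∀ u x → ∣ u ∣² ≡ 1 → ℤ.∣ c₁ u ∣ ℕ.≤ 1 → ℤ.∣ cω u ∣ ℕ.≤ 1 → A x → A (u * x) → u ≡ 1#
  go ⟨ + 0 , + 0 ⟩ _ ()
  go ⟨ + 1 , + 0 ⟩ _ _ _ _ _ _ = refl
  go ⟨ + 1 , + 1 ⟩ _ ()
  go ⟨ -[1+ 0 ] , -[1+ 0 ] ⟩ _ ()
  go ⟨ + 0 , + 1 ⟩ ⟨ a , b ⟩ _ _ _ (0<a , 0≤b) Aux with 0<-b , _ ← subst A (ω*-formula a b) Aux =
    contradiction (ℤ.+-inverseˡ b) (<∧≤⇒sum≢0 0<-b 0≤b)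
  go ⟨ -[1+ 0 ] , + 1 ⟩ ⟨ a , b ⟩ _ _ _ (0<a , 0≤b) Aux with 0<-a-b , _ ← subst A (ω²*-formula a b) Aux =
    contradiction (ℤ.+-inverseˡ (a ℤ.+ b)) (<∧≤⇒sum≢0 0<-a-b (ℤ.+-mono-≤ (ℤ.<⇒≤ 0<a) 0≤b))
  go ⟨ -[1+ 0 ] , + 0 ⟩ ⟨ a , b ⟩ _ _ _ (0<a , 0≤b) Aux with 0<-a , _ ← subst A (ω³*-formula a b) Aux =
    contradiction (ℤ.+-inverseˡ a) (<∧≤⇒sum≢0 0<-a (ℤ.<⇒≤ 0<a))
  go ⟨ + 1 , -[1+ 0 ] ⟩ ⟨ a , b ⟩ _ _ _ (0<a , 0≤b) Aux with _ , 0≤-a ← subst A (ω⁻¹*-formula a b) Aux =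
    contradiction (ℤ.+-inverseʳ a) (<∧≤⇒sum≢0 0<a 0≤-a)
  go ⟨ + 0 , -[1+ 0 ] ⟩ ⟨ a , b ⟩ _ _ _ (0<a , 0≤b) Aux with _ , 0≤-a-b ← subst A (ω⁻²*-formula a b) Aux =
    contradiction (ℤ.+-inverseʳ (a ℤ.+ b)) (<∧≤⇒sum≢0 (ℤ.+-mono-<-≤ 0<a 0≤b) 0≤-a-b)
  go ⟨ + suc (suc _) , _ ⟩ _ _ (s≤s ())
  go ⟨ -[1+ suc _ ] , _ ⟩ _ _ (s≤s ())
  go ⟨ _ , + suc (suc _) ⟩ _ _ _ (s≤s ())
  go ⟨ _ , -[1+ suc _ ] ⟩ _ _ _ (s≤s ())

-- Mutual divisibility makes the quotient a unit, and the only unit carrying a point of the sector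
-- into the sector is 1.
A-associate-unique : ∀ {x y} → A x → A y → x ∣ y → y ∣ x → x ≡ y
A-associate-unique {x} {y} Ax Ay (q , qx≡y) (p , py≡x) =
  trans (sym (*-identityˡ x)) (trans (cong (_* x) (sym q≡1)) qx≡y)
  where
  p*q≡1 : x * (p * q) ≡ x * 1#
  p*q≡1 = begin
    x * (p * q)  ≡⟨ rearrange x p q ⟩
    p * (q * x)  ≡⟨ cong (p *_) qx≡y ⟩
    p * y        ≡⟨ py≡x ⟩
    x            ≡⟨ 𝓞R.*-identityʳ x ⟨
    x * 1#       ∎
    where
    open ≡-Reasoning
    rearrange : ∀ x p q → x * (p * q) ≡ p * (q * x)
    rearrange = solve-∀ 𝓞-ring
  q≡1 : q ≡ 1#
  q≡1 = A-fixes-unit q x (x∣1⇒∣x∣²≡1 (p , *-cancelˡ (A⇒≢0 Ax) p*q≡1)) Ax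
          (subst A (sym qx≡y) Ay)

-- Total in x, so that `normalise` takes no proof argument and can be mapped over lists.
sectorRotation : ∀ x → ∃₂ λ u v → v * u ≡ 1# × (x ≢ 0# → A (u * x))
sectorRotation x with x ≟ 0#
... | yes x≡0 = 1# , 1# , refl , contradiction x≡0
... | no x≢0  = let u , v , vu≡1 , A[ux] = rotation x x≢0 in u , v , vu≡1 , λ _ → A[ux]

-- The associate of x in A; the junk value at 0# is 0#.
normalise : 𝓞 → 𝓞
normalise x = proj₁ (sectorRotation x) * x

A-normalise : ∀ {x} → x ≢ 0# → A (normalise x)
A-normalise {x} x≢0 = proj₂ (proj₂ (proj₂ (sectorRotation x))) x≢0

x∣normalise : ∀ x → x ∣ normalise x
x∣normalise x = proj₁ (sectorRotation x) , refl

normalise∣x : ∀ x → normalise x ∣ x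
normalise∣x x with u , v , vu≡1 , _ ← sectorRotation x =
  v , trans (sym (*-assoc v u x)) (trans (cong (_* x) vu≡1) (*-identityˡ x))

∣normalise∣² : ∀ x → ∣ normalise x ∣² ≡ ∣ x ∣²
∣normalise∣² x with u , v , vu≡1 , _ ← sectorRotation x =
  trans (∣∣²-* u x) (trans (cong (ℕ._* ∣ x ∣²) (x∣1⇒∣x∣²≡1 (v , vu≡1))) (ℕ.*-identityˡ ∣ x ∣²))

-- Moving a unit u into x and its inverse v into q changes neither the product nor any divisibility.
normalise-◇ : ∀ {x q z} → x ≢ 0# → x * q ≡ z → Coprime x q → normalise x ◇ z
normalise-◇ {x} {q} {z} x≢0 xq≡z x⊥q =
  A-normalise x≢0 ,
  (v * q , trans (rearrange v q u x) (trans (cong (_* (x * q)) vu≡1) (trans (*-identityˡ (x * q)) xq≡z))) ,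
  coprime-∣ (normalise∣x x) (u , uvq≡q) x⊥q
  where
  u = proj₁ (sectorRotation x)
  v = proj₁ (proj₂ (sectorRotation x))
  vu≡1 = proj₁ (proj₂ (proj₂ (sectorRotation x)))
  uvq≡q : u * (v * q) ≡ q
  uvq≡q = trans (sym (*-assoc u v q)) (trans (cong (_* q) (trans (*-comm u v) vu≡1)) (*-identityˡ q))
  rearrange : ∀ v q u x → v * q * (u * x) ≡ v * u * (x * q)
  rearrange = solve-∀ 𝓞-ring

-- Multiplicativity

-- Membership in a duplicate-free list has at most one proof, so set equality is already bag
-- equality.
unique∧⇔⇒↭ : ∀ {X : Set} {xs ys : List X} → Unique xs → Unique ys →
  (∀ {v} → v ∈ xs ⇔ v ∈ ys) → xs ↭ ys
unique∧⇔⇒↭ uxs uys xs⇔ys = ∼bag⇒↭ (unique∧set⇒bag uxs uys xs⇔ys)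

-- Injectivity is asked on the members of the list, since (d , e) ↦ `normalise (d * e)` is not
-- injective on all pairs.
map-unique : ∀ {X Y : Set} {f : X → Y} {xs} →
  (∀ {x y} → x ∈ xs → y ∈ xs → f x ≡ f y → x ≡ y) → Unique xs → Unique (map f xs)
map-unique inj []          = []
map-unique inj (x∉xs ∷ u) =
  All.map⁺ (All.tabulate λ y∈xs → All.lookup x∉xs y∈xs ∘ inj (here refl) (there y∈xs)) ∷
  map-unique (λ p q → inj (there p) (there q)) u

sum-map-*ˡ : ∀ {X : Set} c (f : X → ℕ) xs → sum (map (λ x → c ℕ.* f x) xs) ≡ c ℕ.* sum (map f xs)
sum-map-*ˡ c f []       = sym (ℕ.*-zeroʳ c)
sum-map-*ˡ c f (x ∷ xs) =
  trans (cong (c ℕ.* f x ℕ.+_) (sum-map-*ˡ c f xs)) (sym (ℕ.*-distribˡ-+ c (f x) (sum (map f xs))))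

sum-cartesianProduct : ∀ {X Y : Set} (f : X → ℕ) (g : Y → ℕ) xs ys →
  sum (map (λ (x , y) → f x ℕ.* g y) (cartesianProduct xs ys)) ≡ sum (map f xs) ℕ.* sum (map g ys)
sum-cartesianProduct f g []       ys = refl
sum-cartesianProduct f g (x ∷ xs) ys = begin
  sum (map h (map (x ,_) ys ++ cartesianProduct xs ys))
    ≡⟨ cong sum (map-++ h (map (x ,_) ys) (cartesianProduct xs ys)) ⟩
  sum (map h (map (x ,_) ys) ++ map h (cartesianProduct xs ys))
    ≡⟨ sum-++ (map h (map (x ,_) ys)) (map h (cartesianProduct xs ys)) ⟩
  sum (map h (map (x ,_) ys)) ℕ.+ sum (map h (cartesianProduct xs ys))
    ≡⟨ cong₂ ℕ._+_ (trans (cong sum (sym (map-∘ ys))) (sum-map-*ˡ (f x) g ys)) (sum-cartesianProduct f g xs ys) ⟩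
  f x ℕ.* sum (map g ys) ℕ.+ sum (map f xs) ℕ.* sum (map g ys)
    ≡⟨ ℕ.*-distribʳ-+ (sum (map g ys)) (f x) (sum (map f xs)) ⟨
  sum (map f (x ∷ xs)) ℕ.* sum (map g ys)  ∎
  where
  open ≡-Reasoning
  h = λ (x , y) → f x ℕ.* g y

-- The products d e and d′ e′ are associates. As d is coprime to e′, it divides d′, and
-- symmetrically d′ divides d; associates in the sector are equal. The same argument applies to e
-- and e′.
normalise-*-injective : ∀ {x y d e d′ e′} → Coprime x y →
  A d → A e → A d′ → A e′ → d ∣ x → e ∣ y → d′ ∣ x → e′ ∣ y →
  normalise (d * e) ≡ normalise (d′ * e′) → d ≡ d′ × e ≡ e′
normalise-*-injective {x} {y} {d} {e} {d′} {e′} x⊥y Ad Ae Ad′ Ae′ d∣x e∣y d′∣x e′∣y eq =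
  A-associate-unique Ad Ad′ (left d e d′ e′ d∣x e′∣y de∣d′e′) (left d′ e′ d e d′∣x e∣y d′e′∣de) ,
  A-associate-unique Ae Ae′ (right d e d′ e′ e∣y d′∣x de∣d′e′) (right d′ e′ d e e′∣y d∣x d′e′∣de)
  where
  de∣d′e′ : d * e ∣ d′ * e′
  de∣d′e′ = ∣-trans (x∣normalise (d * e)) (subst (_∣ d′ * e′) (sym eq) (normalise∣x (d′ * e′)))
  d′e′∣de : d′ * e′ ∣ d * e
  d′e′∣de = ∣-trans (x∣normalise (d′ * e′)) (subst (_∣ d * e) eq (normalise∣x (d * e)))
  left : ∀ d e d′ e′ → d ∣ x → e′ ∣ y → d * e ∣ d′ * e′ → d ∣ d′
  left d e d′ e′ d∣x e′∣y de∣d′e′ = coprime-divisor (coprime-∣ d∣x e′∣y x⊥y)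
    (subst (d ∣_) (*-comm d′ e′) (∣-trans (e , *-comm e d) de∣d′e′))
  right : ∀ d e d′ e′ → e ∣ y → d′ ∣ x → d * e ∣ d′ * e′ → e ∣ e′
  right d e d′ e′ e∣y d′∣x de∣d′e′ = coprime-divisor (Coprime-sym (coprime-∣ d′∣x e∣y x⊥y))
    (∣-trans (d , refl) de∣d′e′)

-- The cofactor of d e is x′ y′. Of the four coprimalities needed, d with x′ and e with y′ are
-- given, while the mixed ones come from the coprimality of x and y.
◇-* : ∀ {x y d e} → Coprime x y → d ◇ x → e ◇ y → normalise (d * e) ◇ x * y
◇-* {d = d} {e} x⊥y (Ad , d∣x@(x′ , x′d≡x) , d⊥x′) (Ae , e∣y@(y′ , y′e≡y) , e⊥y′) =
  normalise-◇ (*-≢0 (A⇒≢0 Ad) (A⇒≢0 Ae))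
    (trans (rearrange d e x′ y′) (cong₂ _*_ x′d≡x y′e≡y))
    (coprime-* (Coprime-sym (coprime-* (Coprime-sym d⊥x′) (Coprime-sym (coprime-∣ d∣x y′∣y x⊥y))))
               (Coprime-sym (coprime-* (coprime-∣ x′∣x e∣y x⊥y) (Coprime-sym e⊥y′))))
  where
  x′∣x = d , trans (*-comm d x′) x′d≡x
  y′∣y = e , trans (*-comm e y′) y′e≡y
  rearrange : ∀ d e x′ y′ → d * e * (x′ * y′) ≡ x′ * d * (y′ * e)
  rearrange = solve-∀ 𝓞-ring

-- Cancelling d leaves q t′ = x′ y, so t′ divides y; cancelling t′ as well gives q = x′ y′.
cofactor-split : ∀ {d t′ x′ y q} → d * t′ ≢ 0# → Coprime t′ x′ → q * (d * t′) ≡ d * x′ * y →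
  Σ[ y′ ∈ 𝓞 ] (t′ * y′ ≡ y × x′ * y′ ≡ q)
cofactor-split {d} {t′} {x′} {y} {q} t≢0 t′⊥x′ q[dt′]≡dx′y =
  fromDivisor (coprime-divisor t′⊥x′ (q , *-cancelˡ d≢0 d[qt′]≡d[x′y]))
  where
  open ≡-Reasoning
  d≢0 : d ≢ 0#
  d≢0 = x∣y∧y≉0⇒x≉0 (t′ , *-comm t′ d) t≢0
  swap : ∀ d q t′ → d * (q * t′) ≡ q * (d * t′)
  swap = solve-∀ 𝓞-ring
  d[qt′]≡d[x′y] : d * (q * t′) ≡ d * (x′ * y)
  d[qt′]≡d[x′y] = trans (swap d q t′) (trans q[dt′]≡dx′y (*-assoc d x′ y))
  rearrange : ∀ d t′ x′ y′ → d * t′ * (x′ * y′) ≡ d * x′ * (y′ * t′)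
  rearrange = solve-∀ 𝓞-ring
  fromDivisor : t′ ∣ y → Σ[ y′ ∈ 𝓞 ] (t′ * y′ ≡ y × x′ * y′ ≡ q)
  fromDivisor (y′ , y′t′≡y) = y′ , trans (*-comm t′ y′) y′t′≡y , *-cancelˡ t≢0 (begin
    d * t′ * (x′ * y′)  ≡⟨ rearrange d t′ x′ y′ ⟩
    d * x′ * (y′ * t′)  ≡⟨ cong (d * x′ *_) y′t′≡y ⟩
    d * x′ * y          ≡⟨ q[dt′]≡dx′y ⟨
    q * (d * t′)        ≡⟨ *-comm q (d * t′) ⟩
    d * t′ * q          ∎)

-- The factors of t are d = gcd (t , x) and t / d, normalised.
◇-*-split : ∀ {x y t} → x ≢ 0# → t ◇ x * y →
  ∃₂ λ d e → d ◇ x × e ◇ y × t ≡ normalise (d * e)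
◇-*-split {x} {y} {t} x≢0 (At , (q , qt≡xy) , t⊥q) = fromGcd (gcd-factor t x≢0)
  where
  t≢0 = A⇒≢0 At
  fromGcd : (Σ[ d ∈ 𝓞 ] ∃₂ λ t′ x′ → d * t′ ≡ t × d * x′ ≡ x × Coprime t′ x′) →
    ∃₂ λ d e → d ◇ x × e ◇ y × t ≡ normalise (d * e)
  fromGcd (d , t′ , x′ , dt′≡t , dx′≡x , t′⊥x′) =
    fromCofactor (cofactor-split {d} {t′} {x′} (t≢0 ∘ trans (sym dt′≡t)) t′⊥x′
      (trans (cong (q *_) dt′≡t) (trans qt≡xy (cong (_* y) (sym dx′≡x)))))
    where
    d∣t : d ∣ t
    d∣t = t′ , trans (*-comm t′ d) dt′≡t
    t′∣t : t′ ∣ t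
    t′∣t = d , dt′≡t
    d≢0 = x∣y∧y≉0⇒x≉0 d∣t t≢0
    t′≢0 = x∣y∧y≉0⇒x≉0 t′∣t t≢0
    fromCofactor : Σ[ y′ ∈ 𝓞 ] (t′ * y′ ≡ y × x′ * y′ ≡ q) →
      ∃₂ λ d e → d ◇ x × e ◇ y × t ≡ normalise (d * e)
    fromCofactor (y′ , t′y′≡y , x′y′≡q) =
      normalise d , normalise t′ ,
      -- Since d divides t and x′ divides q, their coprimality is inherited from that of t and q;
      -- likewise for t′ and y′.
      normalise-◇ d≢0 dx′≡x (coprime-∣ d∣t (y′ , trans (*-comm y′ x′) x′y′≡q) t⊥q) ,
      normalise-◇ t′≢0 t′y′≡y (coprime-∣ t′∣t (x′ , x′y′≡q) t⊥q) ,
      A-associate-unique At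
        (A-normalise (*-≢0 (A⇒≢0 (A-normalise d≢0)) (A⇒≢0 (A-normalise t′≢0))))
        (∣-trans (subst (_∣ normalise d * normalise t′) dt′≡t (∙-cong-∣ (x∣normalise d) (x∣normalise t′)))
                 (x∣normalise (normalise d * normalise t′)))
        (∣-trans (normalise∣x (normalise d * normalise t′))
                 (subst (normalise d * normalise t′ ∣_) dt′≡t (∙-cong-∣ (normalise∣x d) (normalise∣x t′))))

-- A permutation suffices, because the lists are only summed over and the two enumeration orders
-- need not agree.
unitaryDivisors-* : ∀ {x y} (x≢0 : x ≢ 0#) (y≢0 : y ≢ 0#) (xy≢0 : x * y ≢ 0#) → Coprime x y →
  unitaryDivisors (x * y) xy≢0 ↭
  map (λ (d , e) → normalise (d * e)) (cartesianProduct (unitaryDivisors x x≢0) (unitaryDivisors y y≢0))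
unitaryDivisors-* {x} {y} x≢0 y≢0 xy≢0 x⊥y = unique∧⇔⇒↭
  (unitaryDivisors-unique (x * y) xy≢0)
  (map-unique injective (Unique.cartesianProduct⁺ (unitaryDivisors-unique x x≢0) (unitaryDivisors-unique y y≢0)))
  (mk⇔ to from)
  where
  Dx = unitaryDivisors x x≢0
  Dy = unitaryDivisors y y≢0
  f : 𝓞 × 𝓞 → 𝓞
  f (d , e) = normalise (d * e)
  ∈Dx : ∀ {d} → d ∈ Dx ⇔ d ◇ x
  ∈Dx = ∈-unitaryDivisors x x≢0
  ∈Dy : ∀ {e} → e ∈ Dy ⇔ e ◇ y
  ∈Dy = ∈-unitaryDivisors y y≢0
  ∈Dxy : ∀ {t} → t ∈ unitaryDivisors (x * y) xy≢0 ⇔ t ◇ x * y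
  ∈Dxy = ∈-unitaryDivisors (x * y) xy≢0
  injective : ∀ {p p′} → p ∈ cartesianProduct Dx Dy → p′ ∈ cartesianProduct Dx Dy → f p ≡ f p′ → p ≡ p′
  injective p∈ p′∈ eq =
    let d∈ , e∈ = ∈-cartesianProduct⁻ Dx Dy p∈
        d′∈ , e′∈ = ∈-cartesianProduct⁻ Dx Dy p′∈
        Ad , d∣x , _ = Equivalence.to ∈Dx d∈
        Ae , e∣y , _ = Equivalence.to ∈Dy e∈
        Ad′ , d′∣x , _ = Equivalence.to ∈Dx d′∈
        Ae′ , e′∣y , _ = Equivalence.to ∈Dy e′∈
        d≡d′ , e≡e′ = normalise-*-injective x⊥y Ad Ae Ad′ Ae′ d∣x e∣y d′∣x e′∣y eq
    in cong₂ _,_ d≡d′ e≡e′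
  fromSplit : ∀ {t} → (∃₂ λ d e → d ◇ x × e ◇ y × t ≡ normalise (d * e)) → t ∈ map f (cartesianProduct Dx Dy)
  fromSplit (d , e , d◇x , e◇y , t≡) = subst (_∈ map f (cartesianProduct Dx Dy)) (sym t≡)
    (∈-map⁺ f (∈-cartesianProduct⁺ (Equivalence.from ∈Dx d◇x) (Equivalence.from ∈Dy e◇y)))
  to : ∀ {t} → t ∈ unitaryDivisors (x * y) xy≢0 → t ∈ map f (cartesianProduct Dx Dy)
  to t∈ = fromSplit (◇-*-split x≢0 (Equivalence.to ∈Dxy t∈))
  fromImage : ∀ {t} → Σ[ p ∈ 𝓞 × 𝓞 ] (p ∈ cartesianProduct Dx Dy × t ≡ f p) → t ∈ unitaryDivisors (x * y) xy≢0
  fromImage ((d , e) , p∈ , t≡) =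
    let d∈ , e∈ = ∈-cartesianProduct⁻ Dx Dy p∈
    in Equivalence.from ∈Dxy
         (subst (_◇ x * y) (sym t≡) (◇-* x⊥y (Equivalence.to ∈Dx d∈) (Equivalence.to ∈Dy e∈)))
  from : ∀ {t} → t ∈ map f (cartesianProduct Dx Dy) → t ∈ unitaryDivisors (x * y) xy≢0
  from t∈ = fromImage (∈-map⁻ f t∈)

-- Normalising preserves the norm, so each term is |d|²|e|² and the double sum factors. The product
-- is named `z` so that the lemma applies to a given element with its own proof of being nonzero.
δ*₂-* : ∀ {x y z} (x≢0 : x ≢ 0#) (y≢0 : y ≢ 0#) (z≢0 : z ≢ 0#) → x * y ≡ z → Coprime x y →
  δ*₂ z z≢0 ≡ δ*₂ x x≢0 ℕ.* δ*₂ y y≢0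
δ*₂-* {x} {y} x≢0 y≢0 xy≢0 refl x⊥y = begin
  sum (map ∣_∣² (unitaryDivisors (x * y) xy≢0))    ≡⟨ sum-↭ (↭.map⁺ ∣_∣² (unitaryDivisors-* x≢0 y≢0 xy≢0 x⊥y)) ⟩
  sum (map ∣_∣² (map f (cartesianProduct Dx Dy)))  ≡⟨ cong sum (map-∘ (cartesianProduct Dx Dy)) ⟨
  sum (map (λ p → ∣ f p ∣²) (cartesianProduct Dx Dy))  ≡⟨ cong sum (map-cong ∣f∣² (cartesianProduct Dx Dy)) ⟩
  sum (map (λ (d , e) → ∣ d ∣² ℕ.* ∣ e ∣²) (cartesianProduct Dx Dy))  ≡⟨ sum-cartesianProduct ∣_∣² ∣_∣² Dx Dy ⟩
  sum (map ∣_∣² Dx) ℕ.* sum (map ∣_∣² Dy)          ∎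
  where
  open ≡-Reasoning
  Dx = unitaryDivisors x x≢0
  Dy = unitaryDivisors y y≢0
  f : 𝓞 × 𝓞 → 𝓞
  f (d , e) = normalise (d * e)
  ∣f∣² : ∀ p → ∣ f p ∣² ≡ ∣ proj₁ p ∣² ℕ.* ∣ proj₂ p ∣²
  ∣f∣² (d , e) = trans (∣normalise∣² (d * e)) (∣∣²-* d e)

-- Residues modulo 3

∣i+k*3∣⇒∣i : ∀ i k → 3 ∣ℕ ℤ.∣ i ℤ.+ k ℤ.* + 3 ∣ → 3 ∣ℕ ℤ.∣ i ∣
∣i+k*3∣⇒∣i i k 3∣ = ℤ∣.∣⇒∣ᵤ (ℤ∣.∣m+n∣n⇒∣m {+ 3} {i} (ℤ∣.∣ᵤ⇒∣ 3∣) (ℤ∣.divides k refl))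

-- -1 is not a square modulo 3: the residues 0, 1, 2 give 1, 2, 5.
3∤1+i² : ∀ i → ¬ 3 ∣ℕ ℤ.∣ 1ℤ ℤ.+ i ℤ.* i ∣
3∤1+i² i 3∣1+i² = residue (i %ℕ 3) (n%ℕd<d i 3)
  (∣i+k*3∣⇒∣i (1ℤ ℤ.+ r ℤ.* r) (k ℤ.* (r ℤ.+ r ℤ.+ k ℤ.* + 3)) (subst (λ j → 3 ∣ℕ ℤ.∣ j ∣) 1+i²≡ 3∣1+i²))
  where
  r = + (i %ℕ 3)
  k = i /ℕ 3
  expand : ∀ r k → 1ℤ ℤ.+ (r ℤ.+ k ℤ.* + 3) ℤ.* (r ℤ.+ k ℤ.* + 3) ≡
           1ℤ ℤ.+ r ℤ.* r ℤ.+ k ℤ.* (r ℤ.+ r ℤ.+ k ℤ.* + 3) ℤ.* + 3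
  expand = ℤSolver.solve-∀
  1+i²≡ : 1ℤ ℤ.+ i ℤ.* i ≡ 1ℤ ℤ.+ r ℤ.* r ℤ.+ k ℤ.* (r ℤ.+ r ℤ.+ k ℤ.* + 3) ℤ.* + 3
  1+i²≡ = trans (cong (λ j → 1ℤ ℤ.+ j ℤ.* j) (a≡a%ℕn+[a/ℕn]*n i 3)) (expand r k)
  residue : ∀ r → r ℕ.< 3 → ¬ 3 ∣ℕ ℤ.∣ 1ℤ ℤ.+ + r ℤ.* + r ∣
  residue 0 _ = from-no (3 ∣ℕ? 1)
  residue 1 _ = from-no (3 ∣ℕ? 2)
  residue 2 _ = from-no (3 ∣ℕ? 5)
  residue (suc (suc (suc _))) (s≤s (s≤s (s≤s ())))

-- a² + ab + b² ≡ (a - b)² (mod 3).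
3∤1+∣z∣² : ∀ z → ¬ 3 ∣ℕ suc ∣ z ∣²
3∤1+∣z∣² z@(⟨ a , b ⟩) 3∣ = 3∤1+i² (a ℤ.- b)
  (∣i+k*3∣⇒∣i (1ℤ ℤ.+ (a ℤ.- b) ℤ.* (a ℤ.- b)) (a ℤ.* b) (subst (λ j → 3 ∣ℕ ℤ.∣ j ∣) eq 3∣))
  where
  expand : ∀ a b → 1ℤ ℤ.+ (a ℤ.* (a ℤ.+ b) ℤ.- b ℤ.* (ℤ.- b)) ≡
           1ℤ ℤ.+ (a ℤ.- b) ℤ.* (a ℤ.- b) ℤ.+ a ℤ.* b ℤ.* + 3
  expand = ℤSolver.solve-∀
  eq : + suc ∣ z ∣² ≡ 1ℤ ℤ.+ (a ℤ.- b) ℤ.* (a ℤ.- b) ℤ.+ a ℤ.* b ℤ.* + 3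
  eq = trans (cong (λ i → 1ℤ ℤ.+ i) (sym (c₁-z*conj-z z))) (expand a b)

-- Indecomposable elements and induction on the norm.

1◇z : ∀ z → 1# ◇ z
1◇z z = (+<+ (s≤s z≤n) , +≤+ z≤n) , (z , 𝓞R.*-identityʳ z) , λ d∣1 _ → d∣1

normalise◇z : ∀ {z} → z ≢ 0# → normalise z ◇ z
normalise◇z {z} z≢0 = normalise-◇ z≢0 (𝓞R.*-identityʳ z) (λ _ d∣1 → d∣1)

-- Allows `δ*₂` to be evaluated on an explicit list in place of the filtered box.
δ*₂≡sum : ∀ {z} (z≢0 : z ≢ 0#) {cs} → Unique cs → (∀ {c} → c ◇ z → c ∈ cs) → All (_◇ z) cs →
  δ*₂ z z≢0 ≡ sum (map ∣_∣² cs)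
δ*₂≡sum {z} z≢0 unique complete sound =
  sum-↭ (↭.map⁺ ∣_∣² (unique∧⇔⇒↭ (unitaryDivisors-unique z z≢0) unique (mk⇔
    (complete ∘ Equivalence.to (∈-unitaryDivisors z z≢0))
    (Equivalence.from (∈-unitaryDivisors z z≢0) ∘ All.lookup sound))))

-- If z is a unit, the two trivial unitary divisors coincide and contribute a single 1; otherwise
-- both count.
δ*₂-indecomposable : ∀ {z} (z≢0 : z ≢ 0#) → (∀ {c} → c ◇ z → c ≡ 1# ⊎ c ≡ normalise z) →
  δ*₂ z z≢0 ≡ 1 ⊎ δ*₂ z z≢0 ≡ suc ∣ z ∣²
δ*₂-indecomposable {z} z≢0 trivial with normalise z ≟ 1#
... | yes z~1 = inj₁ (δ*₂≡sum z≢0 {1# ∷ []} ([] ∷ [])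
        ([ here , here ∘ (λ c≡z → trans c≡z z~1) ]′ ∘ trivial)
        (1◇z z ∷ []))
... | no z≁1 = inj₂ (trans
        (δ*₂≡sum z≢0 {1# ∷ normalise z ∷ []} (((z≁1 ∘ sym) ∷ []) ∷ [] ∷ [])
          ([ here , there ∘ here ]′ ∘ trivial)
          (1◇z z ∷ normalise◇z z≢0 ∷ []))
        (cong suc (trans (ℕ.+-identityʳ _) (∣normalise∣² z))))

-- A nonzero nonunit has norm at least 2. This is the descent for the induction.
∣x∣²<∣x*y∣² : ∀ {x y} → x ≢ 0# → y ≢ 0# → ¬ (y ∣ 1#) → ∣ x ∣² ℕ.< ∣ x * y ∣²
∣x∣²<∣x*y∣² {x} {y} x≢0 y≢0 y∤1 = subst (∣ x ∣² ℕ.<_) (sym (∣∣²-* x y))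
  (ℕ.m<m*n ∣ x ∣² ∣ y ∣² {{∣z∣²-nonZero x≢0}}
    (ℕ.≤∧≢⇒< (ℕ.>-nonZero⁻¹ ∣ y ∣² {{∣z∣²-nonZero y≢0}}) (y∤1 ∘ ∣x∣²≡1⇒x∣1 ∘ sym)))

3-prime : Prime 3
3-prime = from-yes (prime? 3)

3∤δ*₂ : ∀ z (z≢0 : z ≢ 0#) → ¬ 3 ∣ℕ δ*₂ z z≢0
3∤δ*₂ z z≢0 = go z z≢0 (<-wellFounded ∣ z ∣²)
  where
  go : ∀ z (z≢0 : z ≢ 0#) → Acc ℕ._<_ ∣ z ∣² → ¬ 3 ∣ℕ δ*₂ z z≢0
  decomposable : ∀ {c} z (z≢0 : z ≢ 0#) → Acc ℕ._<_ ∣ z ∣² →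
    c ≢ 1# → c ≢ normalise z → c ◇ z → ¬ 3 ∣ℕ δ*₂ z z≢0
  -- A nontrivial unitary divisor is found or excluded by a finite search.
  go z z≢0 rec with Any.any? (λ c → ¬? (c ≟ 1#) ×-dec ¬? (c ≟ normalise z)) (unitaryDivisors z z≢0)
  ... | yes proper = let c , c∈ , c≢1 , c≢z = find proper in
    decomposable z z≢0 rec c≢1 c≢z (Equivalence.to (∈-unitaryDivisors z z≢0) c∈)
  ... | no ¬proper = λ 3∣δ →
    [ (λ δ≡1 → from-no (3 ∣ℕ? 1) (subst (3 ∣ℕ_) δ≡1 3∣δ))
    , (λ δ≡1+∣z∣² → 3∤1+∣z∣² z (subst (3 ∣ℕ_) δ≡1+∣z∣² 3∣δ))
    ]′ (δ*₂-indecomposable z≢0 trivial)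
    where
    trivial : ∀ {c} → c ◇ z → c ≡ 1# ⊎ c ≡ normalise z
    trivial {c} c◇z with c ≟ 1# | c ≟ normalise z
    ... | yes c≡1 | _       = inj₁ c≡1
    ... | no _    | yes c≡z = inj₂ c≡z
    ... | no c≢1  | no c≢z  = contradiction (c≢1 , c≢z)
      (All.lookup (All.¬Any⇒All¬ _ ¬proper) (Equivalence.from (∈-unitaryDivisors z z≢0) c◇z))
  decomposable {c} z z≢0 (acc rec) c≢1 c≢z (Ac , (q , qc≡z) , c⊥q) 3∣δ =
    [ go c c≢0 (rec c<z) , go q q≢0 (rec q<z) ]′
      (euclidsLemma (δ*₂ c c≢0) (δ*₂ q q≢0) 3-prime (subst (3 ∣ℕ_) (δ*₂-* c≢0 q≢0 z≢0 cq≡z c⊥q) 3∣δ))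
    where
    cq≡z : c * q ≡ z
    cq≡z = trans (*-comm c q) qc≡z
    c≢0 : c ≢ 0#
    c≢0 = A⇒≢0 Ac
    q≢0 : q ≢ 0#
    q≢0 = x∣y∧y≉0⇒x≉0 (c , cq≡z) z≢0
    -- The only unit in the sector is 1.
    c∤1 : ¬ (c ∣ 1#)
    c∤1 c∣1 = c≢1 (A-associate-unique Ac (proj₁ (1◇z z)) c∣1 (ε∣ʳ c))
    -- Were q a unit, c would be the associate of z in the sector, which is `normalise z`.
    q∤1 : ¬ (q ∣ 1#)
    q∤1 (p , pq≡1) = c≢z (A-associate-unique Ac (A-normalise z≢0)
      (∣-trans (q , qc≡z) (x∣normalise z))
      (∣-trans (normalise∣x z) (p , (begin
        p * z        ≡⟨ cong (p *_) qc≡z ⟨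
        p * (q * c)  ≡⟨ *-assoc p q c ⟨
        p * q * c    ≡⟨ cong (_* c) pq≡1 ⟩
        1# * c       ≡⟨ *-identityˡ c ⟩
        c            ∎))))
      where open ≡-Reasoning
    c<z : ∣ c ∣² ℕ.< ∣ z ∣²
    c<z = subst (λ w → ∣ c ∣² ℕ.< ∣ w ∣²) cq≡z (∣x∣²<∣x*y∣² c≢0 q≢0 q∤1)
    q<z : ∣ q ∣² ℕ.< ∣ z ∣²
    q<z = subst (λ w → ∣ q ∣² ℕ.< ∣ w ∣²) qc≡z (∣x∣²<∣x*y∣² q≢0 c≢0 c∤1)

-- Passage to the fraction in lowest terms.

theorem2p4 : (a b : ℕ) .{{_ : NonZero a}} .{{_ : NonZero b}} →
    Coprimeℕ a b → 3 ∣ℕ a →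
    ¬ (Σ[ z ∈ 𝓞 ] Σ[ z≢0 ∈ z ≢ 0# ] I*₂ z z≢0 ≡ + a / b)
theorem2p4 a b {{_}} {{b≢0}} a⊥b 3∣a (z , z≢0 , I≡a/b) =
  -- Cross-multiplication makes 3 divide `δ*₂` times b; a factor 3 in b would contradict coprimality
  -- with a.
  [ 3∤δ*₂ z z≢0 , (λ 3∣b → contradiction (a⊥b (3∣a , 3∣b)) λ ()) ]′
    (euclidsLemma (δ*₂ z z≢0) b 3-prime (subst (3 ∣ℕ_) (sym δb≡a∣z∣²) (∣m⇒∣m*n ∣ z ∣² 3∣a)))
  where
  δb≡a∣z∣² : δ*₂ z z≢0 ℕ.* b ≡ a ℕ.* ∣ z ∣²
  δb≡a∣z∣² = normalize-injective-≃ (δ*₂ z z≢0) a ∣ z ∣² b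
    -- The proof that b is nonzero is irrelevant in the statement; decidability recovers a relevant
    -- one.
    {{∣z∣²-nonZero z≢0}} {{recompute (ℕ.nonZero? b) b≢0}} I≡a/b
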